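{- Let $q$ be a prime power, $n\ge 1$, and let $e,d,s\ge 0$ be integers with $s\le e$. Let $f\in\mathcal{P}_q(n)$ be non-zero and of degree exactly $d$, with $\mathrm{LM}(f)=m_1$. Then \[ \Pr_{P}\left[\deg(fP)<d+s\right]\le\frac{1}{q^{|U_{s,e}(m_1)|}}, \] where $P$ is uniformly random in $\mathcal{P}_q(n,e)$. In particular, writing $d=(q-1)u+v$ with integers $u,v\ge 0$, $v<q-1$, and letting $m_0=X_1^{q-1}\cdots X_u^{q-1}X_{u+1}^{v}$, the probability above is at most $\dfrac{1}{q^{|U_{s,e}(m_0)|}}$.
   Context: $\mathcal{P}_q(n)$ is the ring $\mathbb{F}_q[X_1,\ldots,X_n]/\langle X_1^q-X_1,\ldots,X_n^q-X_n\rangle$. Its elements are identified with polynomials in $\mathbb{F}_q[X_1,\ldots,X_n]$ of individual degree at most $q-1$ in each variable (the unique reduced representatives), and degree means total degree of this representative; $\deg 0=-\infty$. $\mathcal{P}_q(n,e)$ is the set of elements of $\mathcal{P}_q(n)$ of degree at most $e$. The product $fP$ is taken in $\mathcal{P}_q(n)$. Monomials are ordered by the graded lexicographic order: $m_1>m_2$ if $\deg m_1>\deg m_2$, or $\deg m_1=\deg m_2$ and, writing $m_1=\prod_iX_i^{e_i}$, $m_2=\prod_iX_i^{e_i'}$, for the least $j$ with $e_j\ne e_j'$ we have $e_j>e_j'$. For $f\neq 0$, $\mathrm{LM}(f)$ is the largest monomial with non-zero coefficient in $f$. For a monomial $m=\prod_{j=1}^nX_j^{e_j}$ with all $e_j<q$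 and an integer $t\ge0$, $U_t(m)=\{\prod_{j}X_j^{e_j'} : \sum_je_j'=\deg(m)+t \text{ and } e_j\le e_j'<q \text{ for all } j\}$, and $U_{s,e}(m)=\bigcup_{s\le t\le e}U_t(m)$. When $v=0$ the factor $X_{u+1}^v$ is $1$. -}

module Defs where

open import Level using (Level) renaming (suc to lsuc)
open import Algebra.Core using (Op₁; Op₂)
open import Algebra.Structures using (IsCommutativeRing)
open import Data.Fin.Base as Fin using (Fin; toℕ; fromℕ<)
open import Data.Fin.Properties as Fin using (toℕ<n)
open import Data.Integer.Base using (+_)
open import Data.List.Base as List
  using (List; []; _∷_; length; map; filter; foldr; allFin; cartesianProductWith)
open import Data.List.Membership.Propositional using (_∈_)
open import Data.List.Membership.Propositional.Properties
  using (∈-map⁺; ∈-filter⁺; ∈-allFin; ∈-cartesianProductWith⁺; ∈-length)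
open import Data.List.Properties using (filter-none)
import Data.List.Relation.Unary.All as All
open import Data.List.Relation.Unary.Any using (here)
open import Data.Nat.Base as ℕ
  using (ℕ; zero; suc; _∸_; _<_; _≤_; _^_; NonZero)
open import Data.Nat.Primality using (Prime)
open import Data.Nat.Properties as ℕ
  using (m^n≢0; ≤-trans; <-≤-trans; m∸n≤m; <-cmp)
open import Data.Product.Base using (∃; ∃₂; _×_; _,_)
open import Data.Rational.Base using (ℚ; _/_)
open import Data.Sum.Base using (_⊎_)
open import Data.Vec.Base as Vec using (Vec; []; _∷_; lookup; tabulate; zipWith)
open import Data.Vec.Properties as Vec using (lookup∘tabulate)
open import Function.Base using (_∘_)
open import Function.Bundles using (_↔_; module Inverse)
open import Function.Properties.Inverse using (↔⇒↣)
open import Relation.Binary.Construct.Add.Infimum.NonStrict _≤_ using (_≤₋_; ≤₋-dec; ⊥₋≤_)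
open import Relation.Binary.Construct.Add.Infimum.Strict _<_ using (_<₋_; <₋-dec)
open import Relation.Binary.Definitions
  using (DecidableEquality; Decidable; tri<; tri≈; tri>)
open import Relation.Binary.PropositionalEquality
  using (_≡_; _≢_; refl; sym; trans; cong; subst)
open import Relation.Nullary using (Dec; yes; no; ¬?; _×-dec_)
open import Relation.Nullary.Construct.Add.Infimum using (_₋; ⊥₋; [_])
open import Relation.Nullary.Decidable using (via-injection)
import Relation.Unary as U

private variable
  a p : Level
  A : Set a

PrimePower : ℕ → Set
PrimePower q = ∃₂ λ p k → Prime p × 1 ≤ k × q ≡ p ^ k

record FiniteField c (q : ℕ) : Set (lsuc c) where
  infixl 7 _*_
  infixl 6 _+_
  field
    Carrier           : Set c
    _+_ _*_           : Op₂ Carrier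
    -_                : Op₁ Carrier
    0# 1#             : Carrier
    isCommutativeRing : IsCommutativeRing _≡_ _+_ _*_ -_ 0# 1#
    0≢1               : 0# ≢ 1#
    inverse           : ∀ x → x ≢ 0# → ∃ λ y → x * y ≡ 1#
    enumeration       : Carrier ↔ Fin q

-- The probability of an event for a uniformly random entry of a list; only
-- used for a list containing every element of the sample space exactly once.
Pr : (xs : List A) .{{_ : NonZero (length xs)}} {E : U.Pred A p} → U.Decidable E → ℚ
Pr xs E? = + length (filter E? xs) / length xs

vectors : List A → ∀ k → List (Vec A k)
vectors xs zero    = [] ∷ []
vectors xs (suc k) = cartesianProductWith _∷_ xs (vectors xs k)

∈-vectors : ∀ {xs : List A} {k} (v : Vec A k) → (∀ i → lookup v i ∈ xs) → v ∈ vectors xs k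
∈-vectors []      _  = here refl
∈-vectors (x ∷ v) v⊆ =
  ∈-cartesianProductWith⁺ _∷_ (v⊆ Fin.zero) (∈-vectors v (v⊆ ∘ Fin.suc))

infixl 6 _⊔₋_
_⊔₋_ : ℕ ₋ → ℕ ₋ → ℕ ₋
⊥₋    ⊔₋ y     = y
[ i ] ⊔₋ ⊥₋    = [ i ]
[ i ] ⊔₋ [ j ] = [ i ℕ.⊔ j ]

infix 4 _≤₋?_ _<₋?_
_≤₋?_ : Decidable _≤₋_
_≤₋?_ = ≤₋-dec ℕ._≤?_

_<₋?_ : Decidable _<₋_
_<₋?_ = <₋-dec ℕ._<?_

module ReducedPolynomials {c} {q : ℕ} (F : FiniteField c q) where

  open FiniteField F

  private variable
    n : ℕ

  instance
    q-nonZero : NonZero q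
    q-nonZero = Fin.nonZeroIndex (Inverse.to enumeration 0#)

  infix 4 _≟_
  _≟_ : DecidableEquality Carrier
  _≟_ = via-injection (↔⇒↣ enumeration) Fin._≟_

  elements : List Carrier
  elements = map (Inverse.from enumeration) (allFin q)

  -- X₁^e₁ ⋯ Xₙ^eₙ with all eⱼ < q, given by its exponent vector.
  Monomial : ℕ → Set
  Monomial = Vec (Fin q)

  monomials : ∀ n → List (Monomial n)
  monomials = vectors (allFin q)

  degᵐ : Monomial n → ℕ
  degᵐ m = Vec.sum (Vec.map toℕ m)

  -- Since X^q = X, if i + j ≥ q then X^(i+j) = X^(i+j-(q-1)), and the latter
  -- exponent is again less than q.
  addExp : Fin q → Fin q → Fin q
  addExp i j with toℕ i ℕ.+ toℕ j ℕ.<? q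
  ... | yes i+j<q = fromℕ< i+j<q
  ... | no  _     = fromℕ< (bound (toℕ<n i) (toℕ<n j))
    where
    bound : ∀ {x y r} → x < r → y < r → x ℕ.+ y ∸ (r ∸ 1) < r
    bound {x} {y} {suc r} (ℕ.s≤s x≤r) y<r =
      ≤-trans (ℕ.s≤s (≤-trans (ℕ.∸-monoˡ-≤ r (ℕ.+-monoˡ-≤ y x≤r))
                              (ℕ.≤-reflexive (ℕ.m+n∸m≡n r y)))) y<r

  infixl 7 _·ᵐ_ _·_
  _·ᵐ_ : Monomial n → Monomial n → Monomial n
  _·ᵐ_ = zipWith addExp

  infix 4 _≟ᵐ_
  _≟ᵐ_ : DecidableEquality (Monomial n)
  _≟ᵐ_ = Vec.≡-dec Fin._≟_

  -- A reduced polynomial in X₁,…,Xₙ₊₁ is the vector of its coefficients at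
  -- X₁^0,…,X₁^(q-1), which are reduced polynomials in the other variables.
  data 𝒫 : ℕ → Set c where
    constant : Carrier → 𝒫 0
    expand   : Vec (𝒫 n) q → 𝒫 (suc n)

  coeff : 𝒫 n → Monomial n → Carrier
  coeff (constant a) []      = a
  coeff (expand fs)  (i ∷ m) = coeff (lookup fs i) m

  fromCoeff : (Monomial n → Carrier) → 𝒫 n
  fromCoeff {zero}  g = constant (g [])
  fromCoeff {suc n} g = expand (tabulate λ i → fromCoeff (g ∘ (i ∷_)))

  0ₚ : 𝒫 n
  0ₚ = fromCoeff λ _ → 0#

  polynomials : ∀ n → List (𝒫 n)
  polynomials zero    = map constant elements
  polynomials (suc n) = map expand (vectors (polynomials n) q)

  sum : List Carrier → Carrier
  sum = foldr _+_ 0#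

  -- The coefficient of m in f · g is the sum of coeff f a * coeff g b over all
  -- pairs of monomials (a , b) whose product reduces to m.
  _·_ : 𝒫 n → 𝒫 n → 𝒫 n
  _·_ {n} f g = fromCoeff λ m →
    sum (map (λ (a , b) → coeff f a * coeff g b)
             (filter (λ (a , b) → a ·ᵐ b ≟ᵐ m)
                     (cartesianProductWith _,_ (monomials n) (monomials n))))

  support : 𝒫 n → List (Monomial n)
  support {n} f = filter (λ m → ¬? (coeff f m ≟ 0#)) (monomials n)

  deg : 𝒫 n → ℕ ₋
  deg f = foldr _⊔₋_ ⊥₋ (map (λ m → [ degᵐ m ]) (support f))

  𝒫≤ : ∀ n → ℕ → List (𝒫 n)
  𝒫≤ n e = filter (λ f → deg f ≤₋? [ e ]) (polynomials n)

  infix 4 _>ˡᵉˣ_ _>ᵍʳˡᵉˣ_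
  _>ˡᵉˣ_ : Monomial n → Monomial n → Set
  m >ˡᵉˣ m′ = ∃ λ j → (∀ i → i Fin.< j → lookup m i ≡ lookup m′ i)
                    × lookup m j Fin.> lookup m′ j

  _>ᵍʳˡᵉˣ_ : Monomial n → Monomial n → Set
  m >ᵍʳˡᵉˣ m′ = degᵐ m ℕ.> degᵐ m′ ⊎ (degᵐ m ≡ degᵐ m′ × m >ˡᵉˣ m′)

  IsLM : 𝒫 n → Monomial n → Set c
  IsLM f m = coeff f m ≢ 0# × (∀ m′ → coeff f m′ ≢ 0# → m′ ≢ m → m >ᵍʳˡᵉˣ m′)

  infix 4 _∈U[_]_ _∈U[_⋯_]_
  _∈U[_]_ : Monomial n → ℕ → Monomial n → Set
  m′ ∈U[ t ] m = degᵐ m′ ≡ degᵐ m ℕ.+ t × (∀ j → lookup m j Fin.≤ lookup m′ j)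

  _∈U[_⋯_]_ : Monomial n → ℕ → ℕ → Monomial n → Set
  m′ ∈U[ s ⋯ e ] m = ∃ λ t → t < suc e × s ≤ t × m′ ∈U[ t ] m

  ∈U? : ∀ s e (m m′ : Monomial n) → Dec (m′ ∈U[ s ⋯ e ] m)
  ∈U? s e m m′ = ℕ.anyUpTo? (λ t → s ℕ.≤? t ×-dec
    (degᵐ m′ ℕ.≟ degᵐ m ℕ.+ t ×-dec Fin.all? λ j → lookup m j Fin.≤? lookup m′ j)) (suc e)

  ∣U[_⋯_]_∣ : ℕ → ℕ → Monomial n → ℕ
  ∣U[_⋯_]_∣ {n} s e m = length (filter (∈U? s e m) (monomials n))

  infix 8 1/q^_
  1/q^_ : ℕ → ℚ
  1/q^ k = _/_ (+ 1) (q ^ k) {{m^n≢0 q k}}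

  -- X₁^(q-1) ⋯ X_u^(q-1) X_{u+1}^v.  The variable Xⱼ has index j-1, so the
  -- comparison below is of j-1 with u.
  m₀ : (u v : ℕ) → v < q ∸ 1 → Monomial n
  m₀ u v v<q-1 = tabulate λ j → exponent (toℕ j)
    where
    exponent : ℕ → Fin q
    exponent j with <-cmp j u
    ... | tri< _ _ _ = fromℕ< {q ∸ 1} (ℕ.∸-monoʳ-< ℕ.z<s (ℕ.>-nonZero⁻¹ q))
    ... | tri≈ _ _ _ = fromℕ< {v} (<-≤-trans v<q-1 (m∸n≤m q 1))
    ... | tri> _ _ _ = fromℕ< {0} (ℕ.>-nonZero⁻¹ q)

  coeff-fromCoeff : (g : Monomial n → Carrier) → ∀ m → coeff (fromCoeff g) m ≡ g m
  coeff-fromCoeff g []      = refl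
  coeff-fromCoeff g (i ∷ m) = trans
    (cong (λ f → coeff f m) (lookup∘tabulate (λ i → fromCoeff (g ∘ (i ∷_))) i))
    (coeff-fromCoeff (g ∘ (i ∷_)) m)

  ∈-polynomials : (f : 𝒫 n) → f ∈ polynomials n
  ∈-polynomials (constant a) = ∈-map⁺ constant
    (subst (_∈ elements) (Inverse.strictlyInverseʳ enumeration a)
           (∈-map⁺ (Inverse.from enumeration) (∈-allFin (Inverse.to enumeration a))))
  ∈-polynomials (expand fs) = ∈-map⁺ expand (∈-vectors fs (entries fs))
    where
    entries : ∀ {k} (gs : Vec (𝒫 n) k) i → lookup gs i ∈ polynomials n
    entries (g ∷ gs) Fin.zero    = ∈-polynomials g
    entries (g ∷ gs) (Fin.suc i) = entries gs i

  deg-0ₚ : deg (0ₚ {n}) ≡ ⊥₋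
  deg-0ₚ {n} = cong (foldr _⊔₋_ ⊥₋ ∘ map (λ m → [ degᵐ m ]))
    (filter-none (λ m → ¬? (coeff (0ₚ {n}) m ≟ 0#))
      (All.universal (λ m ≢0 → ≢0 (coeff-fromCoeff (λ _ → 0#) m)) (monomials n)))

  𝒫≤-nonZero : ∀ n e → NonZero (length (𝒫≤ n e))
  𝒫≤-nonZero n e = ℕ.>-nonZero (∈-length
    (∈-filter⁺ (λ f → deg f ≤₋? [ e ]) (∈-polynomials (0ₚ {n}))
               (subst (_≤₋ [ e ]) (sym (deg-0ₚ {n})) (⊥₋≤ [ e ]))))

{-# OPTIONS --safe #-}
module Submission where

-- Let E be the set of P of degree at most e with deg (f · P) < d + s, and U the
-- set U_{s,e}(m₁). Adding to a P in E an arbitrary combination of the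
-- monomials u / m₁ with u in U gives a polynomial of degree at most e, and the
-- result determines both P and the combination: suppose P and P′ give the same
-- result, and let b be the largest monomial where they differ. Then b = u / m₁
-- for some u in U, and as m₁ is the leading monomial of f, all terms of f · P and
-- f · P′ contributing to u agree except the product of m₁ with b. So f · P and
-- f · P′ differ at u, although both vanish there because deg u ≥ d + s. Hence
-- |E| q^|U| is at most the number of polynomials of degree at most e.
--
-- For the second bound, |U_{s,e}(m)| counts the exponent vectors above that of m
-- by their degree. If y ≤ x, replacing two exponents x, y + k by x + k, y does not
-- increase this count, and repeating such moves turns any m of degree d into m₀.

open import Defs
open import Algebra.Bundles using (CommutativeRing)
import Algebra.Properties.Group as GroupProperties
open import Data.Bool.Base using (true; false; if_then_else_)
open import Data.Fin.Base as Fin using (Fin; toℕ; fromℕ<; zero; suc; finToFun; funToFin; remQuot; combine)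
import Data.Fin.Properties as Fin
import Data.Integer.Base as ℤ
import Data.Integer.Properties as ℤ
open import Data.List.Base as List
  using (List; []; _∷_; _++_; length; map; filter; foldr; allFin; cartesianProductWith)
open import Data.List.Membership.Propositional using (_∈_)
open import Data.List.Membership.Propositional.Properties
  using (∈-lookup; ∈-allFin; ∈-filter⁺; ∈-filter⁻; ∈-cartesianProductWith⁺)
import Data.List.Membership.Setoid.Properties as SetoidMembership
open import Data.List.Properties using (filter-++; length-++; filter-none; map-tabulate)
open import Data.List.Relation.Unary.All as ListAll using ([]; _∷_)
open import Data.List.Relation.Unary.AllPairs using ([]; _∷_)
open import Data.List.Relation.Unary.Any as Any using (here; there)
open import Data.List.Relation.Unary.Unique.Propositional using (Unique)
import Data.List.Relation.Unary.Unique.Propositional.Properties as Unique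
open import Data.Nat.Base hiding (_/_)
open import Data.Nat.Induction using (<-wellFounded)
import Data.Nat.ListAction as ListAction
open import Data.Nat.Properties as ℕ hiding (_≟_)
open import Algebra.Properties.CommutativeSemigroup +-commutativeSemigroup using (interchange)
open import Data.Nat.Tactic.RingSolver using (solve-∀)
open import Data.Product.Base using (_×_; _,_; proj₁; proj₂; ∃)
open import Data.Rational.Base using (_/_; toℚᵘ) renaming (_≤_ to _≤ℚ_)
import Data.Rational.Properties as ℚ
open import Data.Rational.Unnormalised.Base using (mkℚᵘ; *≤*)
import Data.Rational.Unnormalised.Properties as ℚᵘ
open import Data.Sum.Base using (_⊎_; inj₁; inj₂)
open import Data.Vec.Base as Vec using (Vec; []; _∷_; lookup; zipWith)
import Data.Vec.Properties as Vec
open import Data.Vec.Relation.Binary.Pointwise.Inductive using (Pointwise; []; _∷_)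
open import Data.Vec.Relation.Unary.All using (All; []; _∷_)
open import Function.Base using (_∘_; id)
open import Function.Bundles using (mk⇔; module Inverse)
open import Induction.WellFounded using (Acc; acc)
open import Level using (Level)
open import Relation.Binary.Construct.Add.Infimum.NonStrict _≤_ using (_≤₋_; [_]; ⊥₋≤_; ≤₋-trans)
open import Relation.Binary.Construct.Add.Infimum.Strict _<_ using (_<₋_; [_])
open import Relation.Binary.Definitions using (tri<; tri≈; tri>)
open import Relation.Binary.PropositionalEquality hiding ([_])
open import Relation.Nullary using (Dec; yes; no; does; ¬_; ¬?; _×-dec_; contradiction)
open import Relation.Nullary.Construct.Add.Infimum using (_₋; ⊥₋; [_])
open import Relation.Nullary.Decidable using (does-⇔)
open import Relation.Unary using (Pred; Decidable)

private variable
  ℓ p : Level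
  A B C : Set ℓ
  n q : ℕ

-- Counting

indicator : {P : Set p} → Dec P → ℕ
indicator P? = if does P? then 1 else 0

length-filter-map : (f : A → B) {P : Pred B p} (P? : Decidable P) → ∀ xs →
  length (filter P? (map f xs)) ≡ length (filter (P? ∘ f) xs)
length-filter-map f P? []       = refl
length-filter-map f P? (x ∷ xs) with does (P? (f x))
... | true  = cong suc (length-filter-map f P? xs)
... | false = length-filter-map f P? xs

length-filter-cartesianProductWith : (f : A → B → C) {P : Pred C p} (P? : Decidable P) → ∀ xs ys →
  length (filter P? (cartesianProductWith f xs ys)) ≡
  ListAction.sum (map (λ x → length (filter (P? ∘ f x) ys)) xs)
length-filter-cartesianProductWith f P? []       ys = refl
length-filter-cartesianProductWith f P? (x ∷ xs) ys = begin
  length (filter P? (map (f x) ys ++ rest))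
    ≡⟨ cong length (filter-++ P? (map (f x) ys) rest) ⟩
  length (filter P? (map (f x) ys) ++ filter P? rest)
    ≡⟨ length-++ (filter P? (map (f x) ys)) ⟩
  length (filter P? (map (f x) ys)) + length (filter P? rest)
    ≡⟨ cong₂ _+_ (length-filter-map (f x) P? ys) (length-filter-cartesianProductWith f P? xs ys) ⟩
  length (filter (P? ∘ f x) ys) + ListAction.sum (map (λ x → length (filter (P? ∘ f x) ys)) xs) ∎
  where
  open ≡-Reasoning
  rest = cartesianProductWith f xs ys

lookup-injective : {xs : List A} → Unique xs → ∀ i j → List.lookup xs i ≡ List.lookup xs j → i ≡ j
lookup-injective (x∉xs ∷ xs!) zero    zero    eq = refl
lookup-injective (x∉xs ∷ xs!) zero    (suc j) eq = contradiction eq (ListAll.lookup x∉xs (∈-lookup j))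
lookup-injective (x∉xs ∷ xs!) (suc i) zero    eq = contradiction (sym eq) (ListAll.lookup x∉xs (∈-lookup i))
lookup-injective (x∉xs ∷ xs!) (suc i) (suc j) eq = cong suc (lookup-injective xs! i j eq)

-- Pigeonhole: coding the pairs of a position in `xs` and an `i` by `Fin (length xs * k)`, the
-- position of `h x i` in `zs` is an injection between finite index sets.
length-*-≤ : {xs : List A} {zs : List B} {k : ℕ} → Unique xs → (h : A → Fin k → B) →
  (∀ {x} → x ∈ xs → ∀ i → h x i ∈ zs) →
  (∀ {x y} → x ∈ xs → y ∈ xs → ∀ i j → h x i ≡ h y j → x ≡ y × i ≡ j) →
  length xs * k ≤ length zs
length-*-≤ {xs = xs} {zs} {k} xs! h h∈zs h-injective = Fin.injective⇒≤ {f = position} position-injective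
  where
  member : ∀ t → let i , j = remQuot {length xs} k t in h (List.lookup xs i) j ∈ zs
  member t = h∈zs (∈-lookup (proj₁ (remQuot {length xs} k t))) _
  position : Fin (length xs * k) → Fin (length zs)
  position t = Any.index (member t)
  position-injective : ∀ {t t′} → position t ≡ position t′ → t ≡ t′
  position-injective {t} {t′} eq = begin
    t                                              ≡⟨ Fin.combine-remQuot {length xs} k t ⟨
    combine (proj₁ (remQuot {length xs} k t)) (proj₂ (remQuot {length xs} k t))
      ≡⟨ cong₂ combine (lookup-injective xs! _ _ (proj₁ same)) (proj₂ same) ⟩
    combine (proj₁ (remQuot {length xs} k t′)) (proj₂ (remQuot {length xs} k t′))
                                                   ≡⟨ Fin.combine-remQuot {length xs} k t′ ⟩
    t′                                             ∎
    where
    open ≡-Reasoning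
    same = h-injective
      (∈-lookup (proj₁ (remQuot {length xs} k t))) (∈-lookup (proj₁ (remQuot {length xs} k t′))) _ _
      (SetoidMembership.index-injective (setoid _) (member t) (member t′) eq)

funToFin-cong : ∀ {m n} {f g : Fin m → Fin n} → f ≗ g → funToFin f ≡ funToFin g
funToFin-cong {zero}  f≗g = refl
funToFin-cong {suc m} f≗g = cong₂ combine (f≗g zero) (funToFin-cong (f≗g ∘ suc))

-- Lets the numbers below `m ^ n` serve as coefficient functions, with pointwise agreement as the
-- only equality of functions involved.
finToFun-injective : ∀ {m n} (i j : Fin (m ^ n)) → finToFun {m} {n} i ≗ finToFun j → i ≡ j
finToFun-injective {m} {n} i j eq = trans (sym (Fin.funToFin-finToFin {n} {m} i))
  (trans (funToFin-cong eq) (Fin.funToFin-finToFin {n} {m} j))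

-- Cross-multiplication, carried out on unnormalised fractions, where numerator and denominator are
-- still `a` and `b`.
a*r≤b⇒a/b≤1/r : ∀ a b r .{{_ : NonZero b}} .{{_ : NonZero r}} → a * r ≤ b → ℤ.+ a / b ≤ℚ ℤ.+ 1 / r
a*r≤b⇒a/b≤1/r a b@(suc b-1) r@(suc r-1) ar≤b = ℚ.toℚᵘ-cancel-≤ (begin
  toℚᵘ (ℤ.+ a / b)   ≃⟨ ℚ.toℚᵘ-fromℚᵘ (mkℚᵘ (ℤ.+ a) b-1) ⟩
  mkℚᵘ (ℤ.+ a) b-1   ≤⟨ *≤* (subst₂ ℤ._≤_ (ℤ.pos-* a r) (sym (ℤ.*-identityˡ (ℤ.+ b))) (ℤ.+≤+ ar≤b)) ⟩
  mkℚᵘ (ℤ.+ 1) r-1   ≃⟨ ℚ.toℚᵘ-fromℚᵘ (mkℚᵘ (ℤ.+ 1) r-1) ⟨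
  toℚᵘ (ℤ.+ 1 / r)   ∎)
  where
  open ℚᵘ.≤-Reasoning

vectors-unique : {xs : List A} → Unique xs → ∀ k → Unique (vectors xs k)
vectors-unique xs! zero    = [] ∷ []
vectors-unique xs! (suc k) = Unique.cartesianProductWith⁺ _∷_ Vec.∷-injective xs! (vectors-unique xs! k)

-- Sums over boxes of exponent vectors

∑ : ℕ → (ℕ → ℕ) → ℕ
∑ zero    g = 0
∑ (suc k) g = g 0 + ∑ k (g ∘ suc)

∑-cong : ∀ k {g h : ℕ → ℕ} → (∀ i → g i ≡ h i) → ∑ k g ≡ ∑ k h
∑-cong zero    g≗h = refl
∑-cong (suc k) g≗h = cong₂ _+_ (g≗h 0) (∑-cong k (g≗h ∘ suc))

∑-mono : ∀ k {g h : ℕ → ℕ} → (∀ i → g i ≤ h i) → ∑ k g ≤ ∑ k h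
∑-mono zero    g≤h = z≤n
∑-mono (suc k) g≤h = +-mono-≤ (g≤h 0) (∑-mono k (g≤h ∘ suc))

∑-split : ∀ a k g → ∑ (a + k) g ≡ ∑ a g + ∑ k (g ∘ (a +_))
∑-split zero    k g = refl
∑-split (suc a) k g = trans (cong (g 0 +_) (∑-split a k (g ∘ suc))) (sym (+-assoc (g 0) _ _))

∑-0 : ∀ k → ∑ k (λ _ → 0) ≡ 0
∑-0 zero    = refl
∑-0 (suc k) = ∑-0 k

∑-distrib-+ : ∀ k g h → ∑ k (λ i → g i + h i) ≡ ∑ k g + ∑ k h
∑-distrib-+ zero    g h = refl
∑-distrib-+ (suc k) g h = trans (cong (g 0 + h 0 +_) (∑-distrib-+ k (g ∘ suc) (h ∘ suc)))
  (interchange (g 0) (h 0) _ _)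

∑-swap : ∀ a b (g : ℕ → ℕ → ℕ) → ∑ a (λ i → ∑ b (g i)) ≡ ∑ b (λ j → ∑ a (λ i → g i j))
∑-swap zero    b g = sym (∑-0 b)
∑-swap (suc a) b g = trans (cong (∑ b (g 0) +_) (∑-swap a b (g ∘ suc)))
  (sym (∑-distrib-+ b (g 0) (λ j → ∑ a (λ i → g (suc i) j))))

-- Turns a count over all exponents in `Fin q` into the sums that define `weightAbove`: only the
-- exponents `x + δ` contribute.
sum-tabulate-from : ∀ {q} (h : Fin q → ℕ) x (g : ℕ → ℕ) → (∀ i → toℕ i < x → h i ≡ 0) →
  (∀ i δ → toℕ i ≡ x + δ → h i ≡ g δ) → ListAction.sum (List.tabulate h) ≡ ∑ (q ∸ x) g
sum-tabulate-from {zero}  h zero    g below above = refl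
sum-tabulate-from {zero}  h (suc x) g below above = refl
sum-tabulate-from {suc q} h zero    g below above = cong₂ _+_ (above zero 0 refl)
  (sum-tabulate-from (h ∘ suc) 0 (g ∘ suc) (λ _ ()) (λ i δ eq → above (suc i) (suc δ) (cong suc eq)))
sum-tabulate-from {suc q} h (suc x) g below above = cong₂ _+_ (below zero z<s)
  (sum-tabulate-from (h ∘ suc) x g (λ i → below (suc i) ∘ s<s) (λ i δ → above (suc i) δ ∘ cong suc))

-- Removing the common rectangle a × b leaves k pairs of runs of g with the
-- same right end, the run on the left-hand side being the shorter one.
∑∑-exchange : ∀ {a b} k (g : ℕ → ℕ) → a ≤ b →
  ∑ a (λ i → ∑ (b + k) (λ j → g (i + j))) ≤ ∑ (a + k) (λ i → ∑ b (λ j → g (i + j)))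
∑∑-exchange {a} {b} k g a≤b = begin
  ∑ a (λ i → ∑ (b + k) (λ j → g (i + j)))
    ≡⟨ ∑-cong a (λ i → ∑-split b k (λ j → g (i + j))) ⟩
  ∑ a (λ i → ∑ b (λ j → g (i + j)) + ∑ k (λ j → g (i + (b + j))))
    ≡⟨ ∑-distrib-+ a _ _ ⟩
  R + ∑ a (λ i → ∑ k (λ j → g (i + (b + j))))
    ≡⟨ cong (R +_) (∑-swap a k _) ⟩
  R + ∑ k (λ j → ∑ a (λ i → g (i + (b + j))))
    ≤⟨ +-monoʳ-≤ R (∑-mono k run) ⟩
  R + ∑ k (λ j → ∑ b (λ i → g (a + j + i)))
    ≡⟨ ∑-split a k _ ⟨
  ∑ (a + k) (λ i → ∑ b (λ j → g (i + j))) ∎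
  where
  open ≤-Reasoning
  R = ∑ a (λ i → ∑ b (λ j → g (i + j)))
  c = b ∸ a
  b≡c+a : c + a ≡ b
  b≡c+a = m∸n+n≡m a≤b
  index : ∀ i c a j → i + (c + a + j) ≡ a + j + (c + i)
  index = solve-∀
  run : ∀ j → ∑ a (λ i → g (i + (b + j))) ≤ ∑ b (λ i → g (a + j + i))
  run j = begin
    ∑ a (λ i → g (i + (b + j)))
      ≡⟨ ∑-cong a (λ i → cong (λ b → g (i + (b + j))) b≡c+a) ⟨
    ∑ a (λ i → g (i + (c + a + j)))
      ≡⟨ ∑-cong a (λ i → cong g (index i c a j)) ⟩
    ∑ a (λ i → g (a + j + (c + i)))
      ≤⟨ m≤n+m _ _ ⟩
    ∑ c (λ i → g (a + j + i)) + ∑ a (λ i → g (a + j + (c + i)))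
      ≡⟨ ∑-split c a _ ⟨
    ∑ (c + a) (λ i → g (a + j + i))
      ≡⟨ cong (λ b → ∑ b (λ i → g (a + j + i))) b≡c+a ⟩
    ∑ b (λ i → g (a + j + i)) ∎

-- The sum of w (Σⱼ (uⱼ ∸ vⱼ)) over all u with vⱼ ≤ uⱼ < q for all j.
weightAbove : ℕ → Vec ℕ n → (ℕ → ℕ) → ℕ
weightAbove q []      w = w 0
weightAbove q (x ∷ v) w = ∑ (q ∸ x) λ i → weightAbove q v (w ∘ (i +_))

weightAbove-cong : ∀ (v : Vec ℕ n) {w w′ : ℕ → ℕ} → (∀ t → w t ≡ w′ t) →
                   weightAbove q v w ≡ weightAbove q v w′
weightAbove-cong []      w≗w′ = w≗w′ 0
weightAbove-cong {q = q} (x ∷ v) w≗w′ = ∑-cong (q ∸ x) λ i → weightAbove-cong v (w≗w′ ∘ (i +_))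

-- With the remaining exponents summed out, the summand depends only on the total excess `i + j` in
-- the first two variables, so this is `∑∑-exchange` for the ranges left above `x + k` and `y + k`.
weightAbove-exchange : ∀ {x y} k (v : Vec ℕ n) w → y ≤ x → x + k ≤ q →
  weightAbove q (x + k ∷ y ∷ v) w ≤ weightAbove q (x ∷ y + k ∷ v) w
weightAbove-exchange {q = q} {x} {y} k v w y≤x x+k≤q = begin
  ∑ a (λ i → ∑ (q ∸ y) λ j → weightAbove q v (w ∘ (i +_) ∘ (j +_)))
    ≡⟨ ∑-cong a (λ i → regroup i (q ∸ y)) ⟩
  ∑ a (λ i → ∑ (q ∸ y) λ j → g (i + j))
    ≡⟨ cong (λ l → ∑ a (λ i → ∑ l λ j → g (i + j))) (shift (≤-trans (+-monoˡ-≤ k y≤x) x+k≤q)) ⟨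
  ∑ a (λ i → ∑ (b + k) λ j → g (i + j))
    ≤⟨ ∑∑-exchange k g (∸-monoʳ-≤ q (+-monoˡ-≤ k y≤x)) ⟩
  ∑ (a + k) (λ i → ∑ b λ j → g (i + j))
    ≡⟨ cong (λ l → ∑ l (λ i → ∑ b λ j → g (i + j))) (shift x+k≤q) ⟩
  ∑ (q ∸ x) (λ i → ∑ b λ j → g (i + j))
    ≡⟨ ∑-cong (q ∸ x) (λ i → regroup i b) ⟨
  ∑ (q ∸ x) (λ i → ∑ b λ j → weightAbove q v (w ∘ (i +_) ∘ (j +_))) ∎
  where
  open ≤-Reasoning
  a = q ∸ (x + k)
  b = q ∸ (y + k)
  g : ℕ → ℕ
  g l = weightAbove q v (w ∘ (l +_))
  regroup : ∀ i l → ∑ l (λ j → weightAbove q v (w ∘ (i +_) ∘ (j +_))) ≡ ∑ l (λ j → g (i + j))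
  regroup i l = ∑-cong l λ j → weightAbove-cong v λ t → cong w (sym (+-assoc i j t))
  shift : ∀ {z} → z + k ≤ q → q ∸ (z + k) + k ≡ q ∸ z
  shift {z} z+k≤q = trans (cong (_+ k) (sym (∸-+-assoc q z k)))
                          (m∸n+n≡m (m+n≤o⇒m≤o∸n k (subst (_≤ q) (+-comm z k) z+k≤q)))

-- The exponents of m₀ in degree d.
packed : ℕ → ∀ n → ℕ → Vec ℕ n
packed Q zero    d = []
packed Q (suc n) d = Q ⊓ d ∷ packed Q n (d ∸ Q)

-- The variables before the `j`-th have already taken `Q * toℕ j` of the degree, as far as it
-- reaches.
lookup-packed : ∀ Q d (j : Fin n) → lookup (packed Q n d) j ≡ Q ⊓ (d ∸ Q * toℕ j)
lookup-packed Q d zero    = cong (λ z → Q ⊓ (d ∸ z)) (sym (*-zeroʳ Q))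
lookup-packed Q d (suc j) = trans (lookup-packed Q (d ∸ Q) j)
  (cong (Q ⊓_) (trans (∸-+-assoc d Q _) (cong (d ∸_) (sym (*-suc Q (toℕ j))))))

-- One step of an insertion sort. Starting from the right-hand side, an exchange moves `k` units
-- from the second exponent to the first, which then has its packed value; the `y` units left in
-- second place are inserted into the rest by induction. The bound on `d` ensures that
-- `packed Q n d` has room for all of `d`.
weightAbove-packed-∷ : ∀ Q n {x d} w → x ≤ Q → d ≤ n * Q →
  weightAbove (suc Q) (packed Q (suc n) (x + d)) w ≤ weightAbove (suc Q) (x ∷ packed Q n d) w
weightAbove-packed-∷ Q zero {x} w x≤Q z≤n = ≤-reflexive
  (cong (λ y → weightAbove (suc Q) (y ∷ []) w)
    (trans (m≥n⇒m⊓n≡n (subst (_≤ Q) (sym (+-identityʳ x)) x≤Q)) (+-identityʳ x)))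
weightAbove-packed-∷ Q (suc n) {x} {d} w x≤Q d≤ = split (≤-total d Q) (≤-total (x + d) Q)
  where
  d∸Q≤ : d ∸ Q ≤ n * Q
  d∸Q≤ = ≤-trans (∸-monoˡ-≤ Q d≤) (≤-reflexive (m+n∸m≡n Q (n * Q)))
  exchange : ∀ k y → y ≤ x → x + k ≡ Q ⊓ (x + d) → y + (d ∸ Q) ≡ x + d ∸ Q → y + k ≡ Q ⊓ d →
    weightAbove (suc Q) (packed Q (2 + n) (x + d)) w ≤ weightAbove (suc Q) (x ∷ packed Q (suc n) d) w
  exchange k y y≤x x+k≡ y+≡ y+k≡ = begin
    weightAbove (suc Q) (Q ⊓ (x + d) ∷ packed Q (suc n) (x + d ∸ Q)) w
      ≡⟨ cong₂ (λ z e → weightAbove (suc Q) (z ∷ packed Q (suc n) e) w) x+k≡ y+≡ ⟨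
    weightAbove (suc Q) (x + k ∷ packed Q (suc n) (y + (d ∸ Q))) w
      ≤⟨ ∑-mono (suc Q ∸ (x + k)) (λ i → weightAbove-packed-∷ Q n (w ∘ (i +_)) (≤-trans y≤x x≤Q) d∸Q≤) ⟩
    weightAbove (suc Q) (x + k ∷ y ∷ packed Q n (d ∸ Q)) w
      ≤⟨ weightAbove-exchange k (packed Q n (d ∸ Q)) w y≤x
           (m≤n⇒m≤1+n (subst (_≤ Q) (sym x+k≡) (m⊓n≤m Q (x + d)))) ⟩
    weightAbove (suc Q) (x ∷ y + k ∷ packed Q n (d ∸ Q)) w
      ≡⟨ cong (λ z → weightAbove (suc Q) (x ∷ z ∷ packed Q n (d ∸ Q)) w) y+k≡ ⟩
    weightAbove (suc Q) (x ∷ Q ⊓ d ∷ packed Q n (d ∸ Q)) w ∎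
    where open ≤-Reasoning
  -- The first exponent absorbs what fits below `Q`. Either it takes all of `d` and nothing remains,
  -- or it is filled and `x + d ∸ Q` remains, or the second exponent is already `Q` and the two
  -- trade places.
  split : d ≤ Q ⊎ Q ≤ d → x + d ≤ Q ⊎ Q ≤ x + d → _
  split (inj₁ d≤Q) (inj₁ x+d≤Q) = exchange d 0 z≤n
    (sym (m≥n⇒m⊓n≡n x+d≤Q))
    (trans (m≤n⇒m∸n≡0 d≤Q) (sym (m≤n⇒m∸n≡0 x+d≤Q)))
    (sym (m≥n⇒m⊓n≡n d≤Q))
  split (inj₁ d≤Q) (inj₂ Q≤x+d) = exchange (Q ∸ x) (x + d ∸ Q)
    (≤-trans (∸-monoˡ-≤ Q (+-monoʳ-≤ x d≤Q)) (≤-reflexive (m+n∸n≡m x Q)))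
    (trans (m+[n∸m]≡n x≤Q) (sym (m≤n⇒m⊓n≡m Q≤x+d)))
    (trans (cong (x + d ∸ Q +_) (m≤n⇒m∸n≡0 d≤Q)) (+-identityʳ _))
    (begin
      x + d ∸ Q + (Q ∸ x)  ≡⟨ +-∸-assoc (x + d ∸ Q) x≤Q ⟨
      x + d ∸ Q + Q ∸ x    ≡⟨ cong (_∸ x) (m∸n+n≡m Q≤x+d) ⟩
      x + d ∸ x            ≡⟨ m+n∸m≡n x d ⟩
      d                    ≡⟨ m≥n⇒m⊓n≡n d≤Q ⟨
      Q ⊓ d                ∎)
    where open ≡-Reasoning
  split (inj₂ Q≤d) _ = exchange (Q ∸ x) x ≤-refl
    (trans (m+[n∸m]≡n x≤Q) (sym (m≤n⇒m⊓n≡m (≤-trans Q≤d (m≤n+m d x)))))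
    (sym (+-∸-assoc x Q≤d))
    (trans (m+[n∸m]≡n x≤Q) (sym (m≤n⇒m⊓n≡m Q≤d)))

sum-bounded : ∀ {Q} {v : Vec ℕ n} → All (_≤ Q) v → Vec.sum v ≤ n * Q
sum-bounded []          = z≤n
sum-bounded (x≤Q ∷ v≤Q) = +-mono-≤ x≤Q (sum-bounded v≤Q)

-- The tail is packed first, by induction; then the head is inserted into the packed tail.
weightAbove-packed-minimal : ∀ {Q} {v : Vec ℕ n} → All (_≤ Q) v → ∀ w →
  weightAbove (suc Q) (packed Q n (Vec.sum v)) w ≤ weightAbove (suc Q) v w
weightAbove-packed-minimal []                        w = ≤-refl
weightAbove-packed-minimal {n = suc n} {Q} {x ∷ v} (x≤Q ∷ v≤Q) w = ≤-trans
  (weightAbove-packed-∷ Q n w x≤Q (sum-bounded v≤Q))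
  (∑-mono (suc Q ∸ x) λ i → weightAbove-packed-minimal v≤Q (w ∘ (i +_)))

-- Exponent vectors

sum-zipWith-+ : (v w : Vec ℕ n) → Vec.sum (zipWith _+_ v w) ≡ Vec.sum v + Vec.sum w
sum-zipWith-+ []      []      = refl
sum-zipWith-+ (x ∷ v) (y ∷ w) = trans (cong (x + y +_) (sum-zipWith-+ v w)) (interchange x y _ _)

sum-mono : {v w : Vec ℕ n} → Pointwise _≤_ v w → Vec.sum v ≤ Vec.sum w
sum-mono []          = z≤n
sum-mono (x≤y ∷ v≤w) = +-mono-≤ x≤y (sum-mono v≤w)

-- A strict increase in one entry could not be made up for by the others.
sum-injective : {v w : Vec ℕ n} → Pointwise _≤_ v w → Vec.sum v ≡ Vec.sum w → v ≡ w
sum-injective []          eq = refl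
sum-injective {v = x ∷ v} {y ∷ w} (x≤y ∷ v≤w) eq = cong₂ _∷_ x≡y
  (sum-injective v≤w (+-cancelˡ-≡ x _ _ (trans eq (cong (_+ Vec.sum w) (sym x≡y)))))
  where
  x≡y : x ≡ y
  x≡y = ≤-antisym x≤y (+-cancelʳ-≤ (Vec.sum v) y x (≤-trans (+-monoʳ-≤ y (sum-mono v≤w)) (≤-reflexive (sym eq))))

-- A base-`q` numeral with the first exponent most significant: on entries below `q` its order is
-- the lexicographic one. It is additive even when entries exceed `q`.
digits : ℕ → Vec ℕ n → ℕ
digits q []              = 0
digits {suc n} q (x ∷ v) = x * q ^ n + digits q v

digits-mono : ∀ {q} {v w : Vec ℕ n} → Pointwise _≤_ v w → digits q v ≤ digits q w
digits-mono []          = z≤n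
digits-mono {suc n} {q} (x≤y ∷ v≤w) = +-mono-≤ (*-monoˡ-≤ (q ^ n) x≤y) (digits-mono v≤w)

digits-+ : ∀ q (v w : Vec ℕ n) → digits q (zipWith _+_ v w) ≡ digits q v + digits q w
digits-+ q []      []      = refl
digits-+ {suc n} q (x ∷ v) (y ∷ w) = trans
  (cong₂ _+_ (*-distribʳ-+ (q ^ n) x y) (digits-+ q v w))
  (interchange (x * q ^ n) (y * q ^ n) _ _)

zipWith-+-cancelˡ-≤ : (v w w′ : Vec ℕ n) → Pointwise _≤_ (zipWith _+_ v w) (zipWith _+_ v w′) →
  Pointwise _≤_ w w′
zipWith-+-cancelˡ-≤ []      []      []        []          = []
zipWith-+-cancelˡ-≤ (x ∷ v) (y ∷ w) (y′ ∷ w′) (≤′ ∷ rest) = +-cancelˡ-≤ x y y′ ≤′ ∷ zipWith-+-cancelˡ-≤ v w w′ rest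

≤₋-⊔₋ˡ : ∀ x y → x ≤₋ x ⊔₋ y
≤₋-⊔₋ˡ ⊥₋    y     = ⊥₋≤ y
≤₋-⊔₋ˡ [ i ] ⊥₋    = [ ≤-refl ]
≤₋-⊔₋ˡ [ i ] [ j ] = [ m≤m⊔n i j ]

≤₋-⊔₋ʳ : ∀ x y → y ≤₋ x ⊔₋ y
≤₋-⊔₋ʳ x     ⊥₋    = ⊥₋≤ (x ⊔₋ ⊥₋)
≤₋-⊔₋ʳ ⊥₋    [ j ] = [ ≤-refl ]
≤₋-⊔₋ʳ [ i ] [ j ] = [ m≤n⊔m i j ]

⊔₋-lub : ∀ {x y z} → x ≤₋ z → y ≤₋ z → x ⊔₋ y ≤₋ z
⊔₋-lub (⊥₋≤ _) y≤z     = y≤z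
⊔₋-lub [ x≤z ] (⊥₋≤ _) = [ x≤z ]
⊔₋-lub [ x≤z ] [ y≤z ] = [ ⊔-lub x≤z y≤z ]

module _ {c} {q : ℕ} (F : FiniteField c q) where

  open ReducedPolynomials F
  open FiniteField F using (Carrier; 0#; isCommutativeRing; enumeration; inverse)
    renaming (_+_ to _+ꟳ_; _*_ to _*ꟳ_)

  private
    commutativeRing : CommutativeRing _ _
    commutativeRing = record { isCommutativeRing = isCommutativeRing }
    module R = CommutativeRing commutativeRing
    module + = GroupProperties R.+-group

  -- Unreduced products and the size of U

  exponents : Monomial n → Vec ℕ n
  exponents = Vec.map toℕ

  -- u is the product of m and b as ordinary monomials: no exponent is reduced.
  IsProduct : (m b u : Monomial n) → Set
  IsProduct m b u = exponents u ≡ zipWith _+_ (exponents m) (exponents b)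

  IsProduct⇒≤ : ∀ (m b u : Monomial n) → IsProduct m b u → ∀ j → lookup m j Fin.≤ lookup u j
  IsProduct⇒≤ (x ∷ m) (y ∷ b) (z ∷ u) eq zero    = m+n≤o⇒m≤o (toℕ x) (≤-reflexive (sym (Vec.∷-injectiveˡ eq)))
  IsProduct⇒≤ (x ∷ m) (y ∷ b) (z ∷ u) eq (suc j) = IsProduct⇒≤ m b u (Vec.∷-injectiveʳ eq) j

  quotient : ∀ (m u : Monomial n) → (∀ j → lookup m j Fin.≤ lookup u j) → ∃ λ b → IsProduct m b u
  quotient []      []      m≤u = [] , refl
  quotient (x ∷ m) (z ∷ u) m≤u with b , eq ← quotient m u (m≤u ∘ suc) =
    fromℕ< (≤-<-trans (m∸n≤m (toℕ z) (toℕ x)) (Fin.toℕ<n z)) ∷ b ,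
    cong₂ _∷_ (sym (trans (cong (toℕ x +_) (Fin.toℕ-fromℕ< _)) (m+[n∸m]≡n (m≤u zero)))) eq

  degᵐ-IsProduct : ∀ (m b u : Monomial n) → IsProduct m b u → degᵐ u ≡ degᵐ m + degᵐ b
  degᵐ-IsProduct m b u eq = trans (cong Vec.sum eq) (sum-zipWith-+ (exponents m) (exponents b))

  -- Counts multiples of `m` selected by the degree of the cofactor alone, by induction on the
  -- variables. A first exponent below `toℕ x` admits no multiple; an exponent `toℕ x + δ` adds `δ`
  -- to the cofactor's degree, hence the shift of `w`.
  length-filter-monomials : ∀ (m : Monomial n) {P : Pred (Monomial n) p} (P? : Decidable P) w →
    (∀ {b u} → IsProduct m b u → indicator (P? u) ≡ w (degᵐ b)) →
    (∀ {u} → P u → ∀ j → lookup m j Fin.≤ lookup u j) →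
    length (filter P? (monomials n)) ≡ weightAbove q (exponents m) w
  length-filter-monomials [] P? w χ≡w P⇒≤ with does (P? []) | χ≡w {[]} {[]} refl
  ... | true  | eq = eq
  ... | false | eq = eq
  length-filter-monomials {n = suc n} (x ∷ m) P? w χ≡w P⇒≤ = begin
    length (filter P? (cartesianProductWith _∷_ (allFin q) (monomials n)))
      ≡⟨ length-filter-cartesianProductWith _∷_ P? (allFin q) (monomials n) ⟩
    ListAction.sum (map (λ i → length (filter (P? ∘ (i ∷_)) (monomials n))) (allFin q))
      ≡⟨ cong ListAction.sum (map-tabulate id λ i → length (filter (P? ∘ (i ∷_)) (monomials n))) ⟩
    ListAction.sum (List.tabulate λ i → length (filter (P? ∘ (i ∷_)) (monomials n)))
      ≡⟨ sum-tabulate-from _ (toℕ x) _ below above ⟩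
    weightAbove q (exponents (x ∷ m)) w ∎
    where
    open ≡-Reasoning
    below : ∀ i → toℕ i < toℕ x → length (filter (P? ∘ (i ∷_)) (monomials n)) ≡ 0
    below i i<x = cong length (filter-none (P? ∘ (i ∷_))
      (ListAll.universal (λ u Pu → <⇒≱ i<x (P⇒≤ Pu zero)) (monomials n)))
    above : ∀ i δ → toℕ i ≡ toℕ x + δ →
      length (filter (P? ∘ (i ∷_)) (monomials n)) ≡ weightAbove q (exponents m) (w ∘ (δ +_))
    above i δ i≡x+δ = length-filter-monomials m (P? ∘ (i ∷_)) (w ∘ (δ +_))
      (λ {b} eq → trans
        (χ≡w {fromℕ< δ<q ∷ b} (cong₂ _∷_ (trans i≡x+δ (cong (toℕ x +_) (sym (Fin.toℕ-fromℕ< δ<q)))) eq))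
        (cong (λ k → w (k + degᵐ b)) (Fin.toℕ-fromℕ< δ<q)))
      (λ Pu → P⇒≤ Pu ∘ suc)
      where
      δ<q : δ < q
      δ<q = ≤-<-trans (m+n≤o⇒n≤o (toℕ x) (≤-reflexive (sym i≡x+δ))) (Fin.toℕ<n i)

  ∣U∣≡weightAbove : ∀ s e (m : Monomial n) →
    ∣U[ s ⋯ e ] m ∣ ≡ weightAbove q (exponents m) (λ t → indicator (s ≤? t ×-dec t ≤? e))
  ∣U∣≡weightAbove s e m = length-filter-monomials m (∈U? s e m) _
    (λ {b} {u} eq → cong (λ b → if b then 1 else 0) (does-⇔ (mk⇔
      (λ (t , t<1+e , s≤t , deg≡ , _) → 
        let t≡ = +-cancelˡ-≡ (degᵐ m) _ _ (trans (sym deg≡) (degᵐ-IsProduct m b u eq)) in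
        subst (s ≤_) t≡ s≤t , subst (_≤ e) t≡ (s≤s⁻¹ t<1+e))
      (λ (s≤b , b≤e) → degᵐ b , s≤s b≤e , s≤b , degᵐ-IsProduct m b u eq , IsProduct⇒≤ m b u eq))
      (∈U? s e m u) (s ≤? degᵐ b ×-dec degᵐ b ≤? e)))
    (λ (_ , _ , _ , _ , m≤u) → m≤u)

  -- Minimality of U at m₀

  exponents-≤ : (m : Monomial n) → All (_≤ q ∸ 1) (exponents m)
  exponents-≤ []      = []
  exponents-≤ (x ∷ m) = ∸-monoˡ-≤ 1 (Fin.toℕ<n x) ∷ exponents-≤ m

  -- When variable `j` is reached, the degree still to be placed is at least `Q` for `j` below `u`,
  -- exactly `v` at `u`, and zero beyond.
  exponents-m₀ : ∀ u v v<q-1 → exponents (m₀ {n} u v v<q-1) ≡ packed (q ∸ 1) n ((q ∸ 1) * u + v)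
  exponents-m₀ {n} u v v<q-1 = lookup-ext λ j → trans (Vec.lookup-map j toℕ (m₀ {n} u v v<q-1))
    (trans (entry j) (sym (lookup-packed (q ∸ 1) _ j)))
    where
    lookup-ext : ∀ {k} {v w : Vec ℕ k} → (∀ j → lookup v j ≡ lookup w j) → v ≡ w
    lookup-ext {v = v} {w} v≗w =
      trans (sym (Vec.tabulate∘lookup v)) (trans (Vec.tabulate-cong v≗w) (Vec.tabulate∘lookup w))
    Q = q ∸ 1
    d = Q * u + v
    -- The right-hand side involves a local function of m₀, which has no name here.
    expand-m₀ : ∀ j → lookup (m₀ {n} u v v<q-1) j ≡ _
    expand-m₀ j = Vec.lookup∘tabulate {n = n} _ j
    entry : ∀ j → toℕ (lookup (m₀ {n} u v v<q-1) j) ≡ Q ⊓ (d ∸ Q * toℕ j)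
    entry j rewrite expand-m₀ j with <-cmp (toℕ j) u
    ... | tri< j<u _ _ = trans (Fin.toℕ-fromℕ< _) (sym (m≤n⇒m⊓n≡m (m+n≤o⇒m≤o∸n Q (begin
        Q + Q * toℕ j    ≡⟨ *-suc Q (toℕ j) ⟨
        Q * suc (toℕ j)  ≤⟨ *-monoʳ-≤ Q j<u ⟩
        Q * u            ≤⟨ m≤m+n (Q * u) v ⟩
        d                ∎))))
      where open ≤-Reasoning
    ... | tri≈ _ refl _ = trans (Fin.toℕ-fromℕ< _) (sym (trans
        (cong (Q ⊓_) (m+n∸m≡n (Q * toℕ j) v)) (m≥n⇒m⊓n≡n (<⇒≤ v<q-1))))
    ... | tri> _ _ j>u = trans (Fin.toℕ-fromℕ< _) (sym (trans
        (cong (Q ⊓_) (m≤n⇒m∸n≡0 (begin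
          Q * u + v    ≤⟨ +-monoʳ-≤ (Q * u) (<⇒≤ v<q-1) ⟩
          Q * u + Q    ≡⟨ +-comm (Q * u) Q ⟩
          Q + Q * u    ≡⟨ *-suc Q u ⟨
          Q * suc u    ≤⟨ *-monoʳ-≤ Q j>u ⟩
          Q * toℕ j    ∎))) (⊓-zeroʳ Q)))
      where open ≤-Reasoning

  ∣U∣-m₀-minimal : ∀ s e u v v<q-1 (m : Monomial n) → degᵐ m ≡ (q ∸ 1) * u + v →
    ∣U[ s ⋯ e ] (m₀ {n} u v v<q-1) ∣ ≤ ∣U[ s ⋯ e ] m ∣
  ∣U∣-m₀-minimal {n} s e u v v<q-1 m deg≡ = begin
    ∣U[ s ⋯ e ] (m₀ {n} u v v<q-1) ∣
      ≡⟨ ∣U∣≡weightAbove s e (m₀ {n} u v v<q-1) ⟩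
    weightAbove q (exponents (m₀ {n} u v v<q-1)) w
      -- The minimality of packed vectors concerns bounds of the form `suc Q`; as `q` is non-zero,
      -- `Q = q ∸ 1` fits.
      ≡⟨ cong₂ (λ q v → weightAbove q v w) (sym (suc-pred q))
           (trans (exponents-m₀ u v v<q-1) (cong (packed (q ∸ 1) n) (sym deg≡))) ⟩
    weightAbove (suc (q ∸ 1)) (packed (q ∸ 1) n (Vec.sum (exponents m))) w
      ≤⟨ weightAbove-packed-minimal (exponents-≤ m) w ⟩
    weightAbove (suc (q ∸ 1)) (exponents m) w
      ≡⟨ cong (λ q → weightAbove q (exponents m) w) (suc-pred q) ⟩
    weightAbove q (exponents m) w
      ≡⟨ ∣U∣≡weightAbove s e m ⟨
    ∣U[ s ⋯ e ] m ∣ ∎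
    where
    open ≤-Reasoning
    w = λ t → indicator (s ≤? t ×-dec t ≤? e)

  -- The graded lexicographic order as an order of natural numbers. The rank is
  -- linear in the exponents with non-negative weights, and reducing a product
  -- only lowers exponents, so rank (m ·ᵐ b) ≤ rank m + rank b.
  rank : Monomial n → ℕ
  rank {n} m = degᵐ m * q ^ n + digits q (exponents m)

  digits<q^n : (m : Monomial n) → digits q (exponents m) < q ^ n
  digits<q^n []              = z<s
  digits<q^n {suc n} (x ∷ m) = begin-strict
    toℕ x * q ^ n + digits q (exponents m)  <⟨ +-monoʳ-< (toℕ x * q ^ n) (digits<q^n m) ⟩
    toℕ x * q ^ n + q ^ n                   ≡⟨ +-comm (toℕ x * q ^ n) (q ^ n) ⟩
    suc (toℕ x) * q ^ n                     ≤⟨ *-monoˡ-≤ (q ^ n) (Fin.toℕ<n x) ⟩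
    q * q ^ n                               ∎
    where open ≤-Reasoning

  -- The digits stay below `q ^ n`, so they cannot outweigh the leading coefficient. That
  -- coefficient is the total degree in `rank` and the first exponent in the lexicographic
  -- comparison.
  *q^n+digits-mono : ∀ {x y} (m m′ : Monomial n) → x < y →
    x * q ^ n + digits q (exponents m) < y * q ^ n + digits q (exponents m′)
  *q^n+digits-mono {n} {x} {y} m m′ x<y = begin-strict
    x * q ^ n + digits q (exponents m)  <⟨ +-monoʳ-< (x * q ^ n) (digits<q^n m) ⟩
    x * q ^ n + q ^ n                     ≡⟨ +-comm (x * q ^ n) (q ^ n) ⟩
    suc x * q ^ n                         ≤⟨ *-monoˡ-≤ (q ^ n) x<y ⟩
    y * q ^ n                             ≤⟨ m≤m+n _ _ ⟩
    y * q ^ n + digits q (exponents m′) ∎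
    where open ≤-Reasoning

  digits->ˡᵉˣ : (m m′ : Monomial n) → m >ˡᵉˣ m′ → digits q (exponents m′) < digits q (exponents m)
  digits->ˡᵉˣ (x ∷ m) (y ∷ m′) (zero  , agree , x>y) = *q^n+digits-mono m′ m x>y
  digits->ˡᵉˣ (x ∷ m) (y ∷ m′) (suc j , agree , m>m′) with refl ← agree zero z<s =
    +-monoʳ-< (toℕ x * _) (digits->ˡᵉˣ m m′ (j , (λ i → agree (suc i) ∘ s<s) , m>m′))

  rank->ᵍʳˡᵉˣ : (m m′ : Monomial n) → m >ᵍʳˡᵉˣ m′ → rank m′ < rank m
  rank->ᵍʳˡᵉˣ m m′ (inj₁ deg>) = *q^n+digits-mono m′ m deg>
  rank->ᵍʳˡᵉˣ {n} m m′ (inj₂ (deg≡ , m>m′)) = +-mono-≤-<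
    (≤-reflexive (cong (_* q ^ n) (sym deg≡))) (digits->ˡᵉˣ m m′ m>m′)

  addExp-≤ : ∀ i j → toℕ (addExp i j) ≤ toℕ i + toℕ j
  addExp-≤ i j with toℕ i + toℕ j <? q
  ... | yes i+j<q = ≤-reflexive (Fin.toℕ-fromℕ< i+j<q)
  ... | no  _     = ≤-trans (≤-reflexive (Fin.toℕ-fromℕ< _)) (m∸n≤m _ (q ∸ 1))

  addExp-+ : ∀ {i j k : Fin q} → toℕ k ≡ toℕ i + toℕ j → addExp i j ≡ k
  addExp-+ {i} {j} {k} k≡ with toℕ i + toℕ j <? q
  ... | yes i+j<q = Fin.toℕ-injective (trans (Fin.toℕ-fromℕ< i+j<q) (sym k≡))
  ... | no  i+j≮q = contradiction (subst (_< q) k≡ (Fin.toℕ<n k)) i+j≮q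

  ·ᵐ-≤ : (m b : Monomial n) →
    Pointwise _≤_ (exponents (m ·ᵐ b)) (zipWith _+_ (exponents m) (exponents b))
  ·ᵐ-≤ []      []      = []
  ·ᵐ-≤ (i ∷ m) (j ∷ b) = addExp-≤ i j ∷ ·ᵐ-≤ m b

  IsProduct⇒·ᵐ : (m b u : Monomial n) → IsProduct m b u → m ·ᵐ b ≡ u
  IsProduct⇒·ᵐ []      []      []      eq = refl
  IsProduct⇒·ᵐ (i ∷ m) (j ∷ b) (k ∷ u) eq =
    cong₂ _∷_ (addExp-+ (Vec.∷-injectiveˡ eq)) (IsProduct⇒·ᵐ m b u (Vec.∷-injectiveʳ eq))

  rank-+ : ∀ n (v w : Vec ℕ n) → Vec.sum (zipWith _+_ v w) * q ^ n + digits q (zipWith _+_ v w)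
         ≡ (Vec.sum v * q ^ n + digits q v) + (Vec.sum w * q ^ n + digits q w)
  rank-+ n v w = begin
    Vec.sum (zipWith _+_ v w) * q ^ n + digits q (zipWith _+_ v w)
      ≡⟨ cong₂ (λ s t → s * q ^ n + t) (sum-zipWith-+ v w) (digits-+ q v w) ⟩
    (Vec.sum v + Vec.sum w) * q ^ n + (digits q v + digits q w)
      ≡⟨ cong (_+ (digits q v + digits q w)) (*-distribʳ-+ (q ^ n) (Vec.sum v) (Vec.sum w)) ⟩
    Vec.sum v * q ^ n + Vec.sum w * q ^ n + (digits q v + digits q w)
      ≡⟨ interchange (Vec.sum v * q ^ n) _ _ _ ⟩
    (Vec.sum v * q ^ n + digits q v) + (Vec.sum w * q ^ n + digits q w) ∎
    where open ≡-Reasoning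

  rank-IsProduct : (m b u : Monomial n) → IsProduct m b u → rank u ≡ rank m + rank b
  rank-IsProduct {n} m b u eq = trans (cong (λ v → Vec.sum v * q ^ n + digits q v) eq)
    (rank-+ n (exponents m) (exponents b))

  rank-·ᵐ : (m b : Monomial n) → rank (m ·ᵐ b) ≤ rank m + rank b
  rank-·ᵐ {n} m b = ≤-trans
    (+-mono-≤ (*-monoˡ-≤ (q ^ n) (sum-mono (·ᵐ-≤ m b))) (digits-mono (·ᵐ-≤ m b)))
    (≤-reflexive (rank-+ n (exponents m) (exponents b)))

  exponents-injective : {m m′ : Monomial n} → exponents m ≡ exponents m′ → m ≡ m′
  exponents-injective {m = []}    {[]}     eq = refl
  exponents-injective {m = i ∷ m} {j ∷ m′} eq = cong₂ _∷_
    (Fin.toℕ-injective (Vec.∷-injectiveˡ eq)) (exponents-injective (Vec.∷-injectiveʳ eq))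

  rank-bounded : (m : Monomial n) → rank m ≤ suc (n * (q ∸ 1)) * q ^ n
  rank-bounded {n} m = begin
    degᵐ m * q ^ n + digits q (exponents m)    ≤⟨ +-monoʳ-≤ (degᵐ m * q ^ n) (<⇒≤ (digits<q^n m)) ⟩
    degᵐ m * q ^ n + q ^ n                     ≡⟨ +-comm (degᵐ m * q ^ n) (q ^ n) ⟩
    suc (degᵐ m) * q ^ n                       ≤⟨ *-monoˡ-≤ (q ^ n) (s≤s (sum-bounded (exponents-≤ m))) ⟩
    suc (n * (q ∸ 1)) * q ^ n                  ∎
    where open ≤-Reasoning

  -- Induction from the largest monomial downwards, well-founded because the distance from the rank
  -- to its upper bound decreases at each call.
  rank-induction : (P : Monomial n → Set p) → (∀ m → (∀ m′ → rank m < rank m′ → P m′) → P m) → ∀ m → P m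
  rank-induction {n} P step m = go m (<-wellFounded _)
    where
    go : ∀ m → Acc _<_ (suc (n * (q ∸ 1)) * q ^ n ∸ rank m) → P m
    go m (acc rs) = step m λ m′ m<m′ → go m′ (rs (∸-monoʳ-< m<m′ (rank-bounded m′)))

  -- Reduction never raises the rank, so a smaller first factor can reach `u` only with a larger
  -- second one.
  rank-cofactor : ∀ {m b u : Monomial n} a b′ → IsProduct m b u → a ·ᵐ b′ ≡ u →
    rank a < rank m → rank b < rank b′
  rank-cofactor {m = m} {b} {u} a b′ u≡mb ab′≡u a<m = +-cancelˡ-< (rank m) _ _ (begin-strict
    rank m + rank b   ≡⟨ rank-IsProduct m b u u≡mb ⟨
    rank u            ≡⟨ cong rank ab′≡u ⟨
    rank (a ·ᵐ b′)    ≤⟨ rank-·ᵐ a b′ ⟩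
    rank a + rank b′  <⟨ +-monoˡ-< (rank b′) a<m ⟩
    rank m + rank b′  ∎)
    where open ≤-Reasoning

  -- The product of `m` and `b′` may reach `u` through reduction. Reduction only lowers exponents,
  -- so cancelling `m` gives `b ≤ b′` entrywise; since they differ, `b′` has the larger degree.
  rank-cofactor-≡ : ∀ {m b u : Monomial n} b′ → IsProduct m b u → m ·ᵐ b′ ≡ u →
    b′ ≢ b → rank b < rank b′
  rank-cofactor-≡ {m = m} {b} {u} b′ u≡mb mb′≡u b′≢b =
    *q^n+digits-mono b b′ (≤∧≢⇒< (sum-mono b≤b′)
      λ sum≡ → b′≢b (sym (exponents-injective (sum-injective b≤b′ sum≡))))
    where
    b≤b′ : Pointwise _≤_ (exponents b) (exponents b′)
    b≤b′ = zipWith-+-cancelˡ-≤ (exponents m) _ _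
      (subst (λ v → Pointwise _≤_ v (zipWith _+_ (exponents m) (exponents b′)))
        (trans (cong exponents mb′≡u) u≡mb) (·ᵐ-≤ m b′))

  -- Degrees, coefficients and enumerations

  ∈-monomials : (m : Monomial n) → m ∈ monomials n
  ∈-monomials m = ∈-vectors m (λ i → ∈-allFin (lookup m i))

  deg-upper : ∀ (f : 𝒫 n) m → coeff f m ≢ 0# → [ degᵐ m ] ≤₋ deg f
  deg-upper f m f≢0 = upper (∈-filter⁺ (λ m → ¬? (coeff f m ≟ 0#)) (∈-monomials m) f≢0)
    where
    max : List (Monomial _) → ℕ ₋
    max ms = foldr _⊔₋_ ⊥₋ (map (λ m → [ degᵐ m ]) ms)
    upper : ∀ {ms} → m ∈ ms → [ degᵐ m ] ≤₋ max ms
    upper {_ ∷ ms} (here refl) = ≤₋-⊔₋ˡ [ degᵐ m ] (max ms)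
    upper {_ ∷ ms} (there m∈)  = ≤₋-trans ≤-trans (upper m∈) (≤₋-⊔₋ʳ [ _ ] (max ms))

  deg-least : ∀ (f : 𝒫 n) {x} → (∀ m → coeff f m ≢ 0# → [ degᵐ m ] ≤₋ x) → deg f ≤₋ x
  deg-least {n} f {x} bound = least (support f) λ m∈ →
    bound _ (proj₂ (∈-filter⁻ (λ m → ¬? (coeff f m ≟ 0#)) {xs = monomials n} m∈))
    where
    least : ∀ ms → (∀ {m} → m ∈ ms → [ degᵐ m ] ≤₋ x) → foldr _⊔₋_ ⊥₋ (map (λ m → [ degᵐ m ]) ms) ≤₋ x
    least []       bound = ⊥₋≤ _
    least (m ∷ ms) bound = ⊔₋-lub (bound (here refl)) (least ms (bound ∘ there))

  deg-<⇒coeff≡0 : ∀ (f : 𝒫 n) {k} → deg f <₋ [ k ] → ∀ m → k ≤ degᵐ m → coeff f m ≡ 0#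
  deg-<⇒coeff≡0 f deg< m k≤ with coeff f m ≟ 0#
  ... | yes f≡0 = f≡0
  ... | no  f≢0 = contradiction k≤ (<⇒≱ (bound deg< (deg-upper f m f≢0)))
    where
    bound : ∀ {x j k} → x <₋ [ k ] → [ j ] ≤₋ x → j < k
    bound [ x<k ] [ j≤x ] = ≤-<-trans j≤x x<k

  -- The order compares total degrees first, so its largest monomial attains the degree of `f`.
  degᵐ-LM : ∀ (f : 𝒫 n) {d} m → IsLM f m → deg f ≡ [ d ] → degᵐ m ≡ d
  degᵐ-LM f {d} m (f≢0 , larger) deg≡ = ≤-antisym
    (unbox (subst ([ degᵐ m ] ≤₋_) deg≡ (deg-upper f m f≢0)))
    (unbox (subst (_≤₋ [ degᵐ m ]) deg≡ (deg-least f below)))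
    where
    unbox : ∀ {i j} → [ i ] ≤₋ [ j ] → i ≤ j
    unbox [ i≤j ] = i≤j
    below : ∀ m′ → coeff f m′ ≢ 0# → [ degᵐ m′ ] ≤₋ [ degᵐ m ]
    below m′ f≢0′ with m′ ≟ᵐ m
    ... | yes refl = [ ≤-refl ]
    ... | no m′≢m with larger m′ f≢0′ m′≢m
    ...   | inj₁ deg>       = [ <⇒≤ deg> ]
    ...   | inj₂ (deg≡ , _) = [ ≤-reflexive (sym deg≡) ]

  coeff-injective : {f g : 𝒫 n} → (∀ m → coeff f m ≡ coeff g m) → f ≡ g
  coeff-injective {f = constant a} {constant b} f≗g = cong constant (f≗g [])
  coeff-injective {f = expand fs} {expand gs} f≗g = cong expand (begin
    fs                         ≡⟨ Vec.tabulate∘lookup fs ⟨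
    Vec.tabulate (lookup fs)   ≡⟨ Vec.tabulate-cong (λ i → coeff-injective (f≗g ∘ (i ∷_))) ⟩
    Vec.tabulate (lookup gs)   ≡⟨ Vec.tabulate∘lookup gs ⟩
    gs                         ∎)
    where open ≡-Reasoning

  from-injective : ∀ {i j} → Inverse.from enumeration i ≡ Inverse.from enumeration j → i ≡ j
  from-injective {i} {j} eq = trans (sym (Inverse.strictlyInverseˡ enumeration i))
    (trans (cong (Inverse.to enumeration) eq) (Inverse.strictlyInverseˡ enumeration j))

  monomials-unique : ∀ n → Unique (monomials n)
  monomials-unique = vectors-unique (Unique.allFin⁺ q)

  polynomials-unique : ∀ n → Unique (polynomials n)
  polynomials-unique zero    = Unique.map⁺ (λ { refl → refl }) (Unique.map⁺ from-injective (Unique.allFin⁺ q))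
  polynomials-unique (suc n) = Unique.map⁺ (λ { refl → refl }) (vectors-unique (polynomials-unique n) q)

  -- All other summands cancel, and by uniqueness `x` occurs only once among the entries.
  sum-agree : ∀ {x : A} {xs} {g h : A → Carrier} → Unique xs → x ∈ xs →
    (∀ {y} → y ∈ xs → y ≢ x → g y ≡ h y) → sum (map g xs) ≡ sum (map h xs) → g x ≡ h x
  sum-agree {x = x} {_ ∷ xs} {g} {h} (x∉xs ∷ _) (here refl) agree eq =
    +.∙-cancelʳ (sum (map h xs)) (g x) (h x) (trans (cong (g x +ꟳ_) (sym (rest (ListAll.tabulate id)))) eq)
    where
    rest : ∀ {ys} → ListAll.All (_∈ xs) ys → sum (map g ys) ≡ sum (map h ys)
    rest []         = refl
    rest (y∈ ∷ ys∈) = cong₂ _+ꟳ_ (agree (there y∈) (ListAll.lookup x∉xs y∈ ∘ sym)) (rest ys∈)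
  sum-agree {x = x} {y ∷ xs} {g} {h} (y∉xs ∷ xs!) (there x∈) agree eq = sum-agree xs! x∈ (agree ∘ there)
    (+.∙-cancelˡ (g y) _ _ (trans eq (cong (_+ꟳ sum (map h xs)) (sym (agree (here refl) (ListAll.lookup y∉xs x∈))))))

  *-cancelˡ : ∀ {x y z} → x ≢ 0# → x *ꟳ y ≡ x *ꟳ z → y ≡ z
  *-cancelˡ {x} {y} {z} x≢0 xy≡xz with x⁻¹ , xx⁻¹≡1 ← inverse x x≢0 = begin
    y                 ≡⟨ R.*-identityˡ y ⟨
    R.1# *ꟳ y         ≡⟨ cong (_*ꟳ y) x⁻¹x≡1 ⟨
    x⁻¹ *ꟳ x *ꟳ y     ≡⟨ R.*-assoc x⁻¹ x y ⟩
    x⁻¹ *ꟳ (x *ꟳ y)   ≡⟨ cong (x⁻¹ *ꟳ_) xy≡xz ⟩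
    x⁻¹ *ꟳ (x *ꟳ z)   ≡⟨ R.*-assoc x⁻¹ x z ⟨
    x⁻¹ *ꟳ x *ꟳ z     ≡⟨ cong (_*ꟳ z) x⁻¹x≡1 ⟩
    R.1# *ꟳ z         ≡⟨ R.*-identityˡ z ⟩
    z                 ∎
    where
    open ≡-Reasoning
    x⁻¹x≡1 = trans (R.*-comm x⁻¹ x) xx⁻¹≡1

  -- Comparing the coefficients of f · P and f · P′ at u: in every other pair
  -- (a , b′) contributing to it, either a is not in the support of f or b′ > b.
  coeff-agree-at-cofactor : ∀ (f : 𝒫 n) {m₁ b u} P P′ → IsLM f m₁ → IsProduct m₁ b u →
    coeff (f · P) u ≡ coeff (f · P′) u → (∀ b′ → rank b < rank b′ → coeff P b′ ≡ coeff P′ b′) →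
    coeff P b ≡ coeff P′ b
  coeff-agree-at-cofactor {n} f {m₁} {b} {u} P P′ (f≢0 , larger) u≡m₁b fP≡fP′ agree =
    *-cancelˡ f≢0 (sum-agree pairs! m₁b∈ same
      (trans (sym (coeff-fromCoeff _ u)) (trans fP≡fP′ (coeff-fromCoeff _ u))))
    where
    product-is-u? = λ ((a , b′) : Monomial n × Monomial n) → a ·ᵐ b′ ≟ᵐ u
    allPairs = cartesianProductWith _,_ (monomials n) (monomials n)
    pairs! : Unique (filter product-is-u? allPairs)
    pairs! = Unique.filter⁺ product-is-u?
      (Unique.cartesianProductWith⁺ _,_ (λ { refl → refl , refl }) (monomials-unique n) (monomials-unique n))
    m₁b∈ : (m₁ , b) ∈ filter product-is-u? allPairs
    m₁b∈ = ∈-filter⁺ product-is-u? (∈-cartesianProductWith⁺ _,_ (∈-monomials m₁) (∈-monomials b))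
      (IsProduct⇒·ᵐ m₁ b u u≡m₁b)
    same : ∀ {(a , b′) : Monomial n × Monomial n} → (a , b′) ∈ filter product-is-u? allPairs → (a , b′) ≢ (m₁ , b) →
      coeff f a *ꟳ coeff P b′ ≡ coeff f a *ꟳ coeff P′ b′
    same {a , b′} ab′∈ ab′≢ with proj₂ (∈-filter⁻ product-is-u? {xs = allPairs} ab′∈) | coeff f a ≟ 0# | a ≟ᵐ m₁
    ... | _     | yes fa≡0 | _        = trans (cong (_*ꟳ coeff P b′) fa≡0)
      (trans (R.zeroˡ _) (sym (trans (cong (_*ꟳ coeff P′ b′) fa≡0) (R.zeroˡ _))))
    ... | ab′≡u | no _     | yes refl = cong (coeff f a *ꟳ_)
      (agree b′ (rank-cofactor-≡ b′ u≡m₁b ab′≡u λ { refl → ab′≢ refl }))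
    ... | ab′≡u | no fa≢0  | no a≢m₁  = cong (coeff f a *ꟳ_)
      (agree b′ (rank-cofactor a b′ u≡m₁b ab′≡u (rank->ᵍʳˡᵉˣ m₁ a (larger a fa≢0 a≢m₁))))

  -- Perturbing the polynomials whose product with f has low degree

  module _ (f : 𝒫 n) {m₁ : Monomial n} (lm : IsLM f m₁) (d s e : ℕ) (d≤ : d ≤ degᵐ m₁) where

    private
      U : List (Monomial n)
      U = filter (∈U? s e m₁) (monomials n)

      low? : ∀ P → Dec (deg (f · P) <₋ [ d + s ])
      low? P = deg (f · P) <₋? [ d + s ]

      lows : List (𝒫 n)
      lows = filter low? (𝒫≤ n e)

    ∈U : ∀ i → List.lookup U i ∈U[ s ⋯ e ] m₁
    ∈U i = proj₂ (∈-filter⁻ (∈U? s e m₁) {xs = monomials n} (∈-lookup i))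

    U-lookup-injective : ∀ i j → List.lookup U i ≡ List.lookup U j → i ≡ j
    U-lookup-injective = lookup-injective (Unique.filter⁺ (∈U? s e m₁) (monomials-unique n))

    cofactor? : ∀ b → Dec (∃ λ i → IsProduct m₁ b (List.lookup U i))
    cofactor? b = Fin.any? λ i → Vec.≡-dec ℕ._≟_ _ _

    -- The coefficient at b of the sum of c u · u / m₁ over all u in U.
    perturbation : (Fin (length U) → Fin q) → Monomial n → Carrier
    perturbation c b with cofactor? b
    ... | yes (i , _) = Inverse.from enumeration (c i)
    ... | no  _       = 0#

    perturbation-cofactor : ∀ c {b} i → IsProduct m₁ b (List.lookup U i) →
      perturbation c b ≡ Inverse.from enumeration (c i)
    perturbation-cofactor c {b} i eq with cofactor? b
    -- The search may return another index `j`, but `b` determines its product with `m₁` and `U` has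
    -- no repetitions.
    ... | yes (j , eq′) = cong (Inverse.from enumeration ∘ c)
      (U-lookup-injective j i (exponents-injective (trans eq′ (sym eq))))
    ... | no  ¬∃        = contradiction (i , eq) ¬∃

    perturbation-≡0 : ∀ c b → ¬ (∃ λ i → IsProduct m₁ b (List.lookup U i)) → perturbation c b ≡ 0#
    perturbation-≡0 c b ¬∃ with cofactor? b
    ... | yes ∃i = contradiction ∃i ¬∃
    ... | no  _  = refl

    -- The lower bound puts the elements of `U` in degrees where the products with `f` vanish; the
    -- upper bound keeps perturbed polynomials in `𝒫≤ n e`.
    degᵐ-cofactor : ∀ {b} i → IsProduct m₁ b (List.lookup U i) → s ≤ degᵐ b × degᵐ b ≤ e
    degᵐ-cofactor {b} i eq with t , t<1+e , s≤t , deg≡ , _ ← ∈U i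
      with refl ← +-cancelˡ-≡ (degᵐ m₁) _ _ (trans (sym deg≡) (degᵐ-IsProduct m₁ b (List.lookup U i) eq)) =
      s≤t , s≤s⁻¹ t<1+e

    perturb : 𝒫 n → (Fin (length U) → Fin q) → 𝒫 n
    perturb P c = fromCoeff λ b → coeff P b +ꟳ perturbation c b

    perturb-∈ : ∀ {P} → P ∈ lows → ∀ c → perturb P c ∈ 𝒫≤ n e
    perturb-∈ {P} P∈ c = ∈-filter⁺ (λ P → deg P ≤₋? [ e ]) (∈-polynomials _) (deg-least (perturb P c) bound)
      where
      degP≤e : deg P ≤₋ [ e ]
      degP≤e = proj₂ (∈-filter⁻ (λ P → deg P ≤₋? [ e ]) {xs = polynomials n}
        (proj₁ (∈-filter⁻ low? {xs = 𝒫≤ n e} P∈)))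
      bound : ∀ b → coeff (perturb P c) b ≢ 0# → [ degᵐ b ] ≤₋ [ e ]
      bound b ≢0 with cofactor? b
      ... | yes (i , eq) = [ proj₂ (degᵐ-cofactor i eq) ]
      ... | no  ¬∃       = ≤₋-trans ≤-trans (deg-upper P b λ P≡0 → ≢0 (trans (coeff-fromCoeff _ b)
        (trans (cong₂ _+ꟳ_ P≡0 (perturbation-≡0 c b ¬∃)) (R.+-identityˡ 0#)))) degP≤e

    perturb-injective : ∀ {P P′} → P ∈ lows → P′ ∈ lows → ∀ c c′ →
      perturb P c ≡ perturb P′ c′ → P ≡ P′ × c ≗ c′
    perturb-injective {P} {P′} P∈ P′∈ c c′ eq = coeff-injective P≗P′ , λ i →
      -- Once `P` and `P′` agree, cancelling them at the cofactor of the `i`-th element of `U`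
      -- isolates `c i` and `c′ i`.
      let b , u≡m₁b = quotient m₁ (List.lookup U i) (proj₂ (proj₂ (proj₂ (proj₂ (∈U i)))))
      in from-injective (trans (sym (perturbation-cofactor c i u≡m₁b))
           (trans (+.∙-cancelˡ (coeff P b) _ _ (trans (sums b) (cong (_+ꟳ perturbation c′ b) (sym (P≗P′ b)))))
             (perturbation-cofactor c′ i u≡m₁b)))
      where
      sums : ∀ b → coeff P b +ꟳ perturbation c b ≡ coeff P′ b +ꟳ perturbation c′ b
      sums b = trans (sym (coeff-fromCoeff _ b)) (trans (cong (λ P → coeff P b) eq) (coeff-fromCoeff _ b))
      vanish : ∀ {P} → P ∈ lows → ∀ u → d + s ≤ degᵐ u → coeff (f · P) u ≡ 0#
      vanish {P} P∈ = deg-<⇒coeff≡0 (f · P) (proj₂ (∈-filter⁻ low? {xs = 𝒫≤ n e} P∈))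
      step : ∀ b → (∀ b′ → rank b < rank b′ → coeff P b′ ≡ coeff P′ b′) → coeff P b ≡ coeff P′ b
      step b agree with cofactor? b
      ... | yes (i , u≡m₁b) = coeff-agree-at-cofactor f P P′ lm u≡m₁b
        (trans (vanish P∈ u high) (sym (vanish P′∈ u high))) agree
        where
        u = List.lookup U i
        high : d + s ≤ degᵐ u
        high = ≤-trans (+-mono-≤ d≤ (proj₁ (degᵐ-cofactor i u≡m₁b)))
          (≤-reflexive (sym (degᵐ-IsProduct m₁ b u u≡m₁b)))
      -- Away from the cofactors both perturbations are zero, so the equal sums already give equal
      -- coefficients.
      ... | no ¬∃ = +.∙-cancelʳ (perturbation c b) _ _ (trans (sums b)
        (cong (coeff P′ b +ꟳ_) (trans (perturbation-≡0 c′ b ¬∃) (sym (perturbation-≡0 c b ¬∃)))))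
      P≗P′ : ∀ b → coeff P b ≡ coeff P′ b
      P≗P′ = rank-induction _ step

    -- Through `finToFun`, the numbers below `q ^ length U` run over all choices of coefficients for
    -- the perturbation.
    length-lows : length lows * q ^ ∣U[ s ⋯ e ] m₁ ∣ ≤ length (𝒫≤ n e)
    length-lows = length-*-≤
      (Unique.filter⁺ low? (Unique.filter⁺ (λ P → deg P ≤₋? [ e ]) (polynomials-unique n)))
      (λ P i → perturb P (finToFun i)) (λ P∈ i → perturb-∈ P∈ (finToFun i))
      (λ P∈ P′∈ i j eq → let P≡P′ , i≗j = perturb-injective P∈ P′∈ (finToFun i) (finToFun j) eq
                         in P≡P′ , finToFun-injective i j i≗j)

lemma3p3 : ∀ {c} {q : ℕ} → PrimePower q → (F : FiniteField c q) →
    let open ReducedPolynomials F in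
    ∀ (n e d s : ℕ) → n ≥ 1 → s ≤ e →
    (f : 𝒫 n) → f ≢ 0ₚ → deg f ≡ [ d ] →
    (m₁ : Monomial n) → IsLM f m₁ →
    let prob = Pr (𝒫≤ n e) {{𝒫≤-nonZero n e}} (λ P → deg (f · P) <₋? [ d + s ]) in
    prob ≤ℚ 1/q^ ∣U[ s ⋯ e ] m₁ ∣
    × (∀ u v (v<q-1 : v < q ∸ 1) → d ≡ (q ∸ 1) * u + v →
    prob ≤ℚ 1/q^ ∣U[ s ⋯ e ] (m₀ {n} u v v<q-1) ∣)
lemma3p3 {q = q} _ F n e d s _ _ f _ deg≡ m₁ lm =
  bound ≤-refl , λ u v v<q-1 d≡ → bound (∣U∣-m₀-minimal F s e u v v<q-1 m₁ (trans degᵐ≡d d≡))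
  where
  open ReducedPolynomials F
  degᵐ≡d : degᵐ m₁ ≡ d
  degᵐ≡d = degᵐ-LM F f m₁ lm deg≡
  low? = λ P → deg (f · P) <₋? [ d + s ]
  -- A smaller exponent only weakens the bound, so taking `k` to be the size of U at `m₁` or at `m₀`
  -- gives the two claims.
  bound : ∀ {k} → k ≤ ∣U[ s ⋯ e ] m₁ ∣ → Pr (𝒫≤ n e) {{𝒫≤-nonZero n e}} low? ≤ℚ 1/q^ k
  bound {k} k≤∣U∣ =
    a*r≤b⇒a/b≤1/r (length lows) (length (𝒫≤ n e)) (q ^ k) {{𝒫≤-nonZero n e}} {{m^n≢0 q k}}
      (≤-trans (*-monoʳ-≤ (length lows) (^-monoʳ-≤ q k≤∣U∣))
               (length-lows F f lm d s e (≤-reflexive (sym degᵐ≡d))))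
    where lows = filter low? (𝒫≤ n e)
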